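{- Let $r\ge 1$ be an integer. If $d=2^r$, then $\gamma_{d-1}^{\mathrm L}(Q_d)=2^{\,2^r-r}$, and if $d=2^r+1$, then $\gamma_{d-1}^{\mathrm L}(Q_d)=2^{\,2^r-r+1}$.
   Context: All graphs are finite and simple; $N_G(u)$ is the open neighborhood of $u$ in $G$. A set $D\subseteq V(G)$ is a dominating set if every vertex of $V(G)\setminus D$ has a neighbor in $D$. For an integer $k\ge 0$, a dominating set $D$ of $G$ is a $k$-limited dominating set if $|N_G(u)\setminus D|\le k$ for every $u\in D$, and $\gamma_k^{\mathrm L}(G)$ is the minimum cardinality of a $k$-limited dominating set of $G$. The hypercube $Q_d$ has vertex set $\{0,1\}^d$, two vertices being adjacent if and only if they differ in exactly one coordinate. -}

module Defs where

open import Data.Bool using (Bool)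
import Data.Bool as Bool
open import Data.Fin using (Fin)
open import Data.Fin.Properties using (2↔Bool; *↔×; any?; all?; _≟_)
open import Data.Fin.Subset using (Subset; ⊤; ∣_∣; _─_)
import Data.Fin.Subset as Subset
open import Data.Fin.Subset.Properties
  using (_∈?_; ∈⊤; anySubset?; p─⊤≡⊥; ∣⊥∣≡0)
open import Data.Nat using (ℕ; zero; suc; _^_; _≤_; _<_; _≤?_; _<?_; z≤n)
open import Data.Nat.Induction using (<-wellFounded)
open import Data.Nat.Properties using (≮⇒≥)
open import Data.Product using (_×_; _,_; proj₁; proj₂; ∃; ∃-syntax; ∃!; uncurry)
open import Data.Product.Function.NonDependent.Propositional using (_×-↔_)
open import Data.Vec using (Vec; []; _∷_; lookup; tabulate; uncons)
open import Function using (_∘_; _↔_; mk↔ₛ′; Inverse)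
open import Function.Construct.Composition using (_↔-∘_)
open import Induction.WellFounded using (Acc; acc)
open import Level using (0ℓ)
open import Relation.Binary using (Rel; Decidable; Symmetric; Irreflexive)
open import Relation.Binary.PropositionalEquality
  using (_≡_; _≢_; refl; sym; subst)
open import Relation.Nullary
  using (¬_; Dec; yes; no; does; contradiction; ¬?; map′; _×-dec_; _→-dec_)

record Graph : Set₁ where
  field
    Vertex      : Set
    order       : ℕ
    enumeration : Fin order ↔ Vertex
    Adj         : Rel Vertex 0ℓ
    adj?        : Decidable Adj
    adj-sym     : Symmetric Adj
    adj-irrefl  : Irreflexive _≡_ Adj

  vertex : Fin order → Vertex
  vertex = Inverse.to enumeration

  index : Vertex → Fin order
  index = Inverse.from enumeration

  VertexSet : Set
  VertexSet = Subset order

  infix 4 _∈_ _∉_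

  _∈_ : Vertex → VertexSet → Set
  v ∈ D = index v Subset.∈ D

  _∉_ : Vertex → VertexSet → Set
  v ∉ D = ¬ (v ∈ D)

  N : Vertex → VertexSet
  N u = tabulate (λ i → does (adj? u (vertex i)))

  IsDominating : VertexSet → Set
  IsDominating D = ∀ v → v ∉ D → ∃[ u ] (u ∈ D × Adj v u)

  IsLimitedDominating : ℕ → VertexSet → Set
  IsLimitedDominating k D = IsDominating D × (∀ u → u ∈ D → ∣ N u ─ D ∣ ≤ k)

  IsMinimumLimitedDominating : ℕ → VertexSet → Set
  IsMinimumLimitedDominating k D =
    IsLimitedDominating k D × (∀ D′ → IsLimitedDominating k D′ → ∣ D ∣ ≤ ∣ D′ ∣)

  private
    vertex-index : ∀ v → vertex (index v) ≡ v
    vertex-index = Inverse.strictlyInverseˡ enumeration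

    anyVertex? : {P : Vertex → Set} → (∀ v → Dec (P v)) → Dec (∃ P)
    anyVertex? {P} P? = map′
      (λ (i , p) → vertex i , p)
      (λ (v , p) → index v , subst P (sym (vertex-index v)) p)
      (any? (P? ∘ vertex))

    allVertices? : {P : Vertex → Set} → (∀ v → Dec (P v)) → Dec (∀ v → P v)
    allVertices? {P} P? = map′
      (λ f v → subst P (vertex-index v) (f (index v)))
      (λ f i → f (vertex i))
      (all? (P? ∘ vertex))

  isLimitedDominating? : ∀ k D → Dec (IsLimitedDominating k D)
  isLimitedDominating? k D =
    allVertices? (λ v → ¬? (index v ∈? D) →-dec
      anyVertex? (λ u → (index u ∈? D) ×-dec adj? v u))
    ×-dec
    allVertices? (λ u → (index u ∈? D) →-dec (∣ N u ─ D ∣ ≤? k))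

  ⊤-isLimitedDominating : ∀ k → IsLimitedDominating k ⊤
  ⊤-isLimitedDominating k =
    (λ v v∉⊤ → contradiction ∈⊤ v∉⊤) ,
    (λ u _ → subst (_≤ k) (sym (empty u)) z≤n)
    where
    empty : ∀ u → ∣ N u ─ ⊤ ∣ ≡ 0
    empty u rewrite p─⊤≡⊥ (N u) = ∣⊥∣≡0 order

  -- Abstract so that γᴸ is never unfolded into an exhaustive search;
  -- the type determines the cardinality of the set uniquely.
  abstract
    minimumLimitedDominating : ∀ k → ∃ (IsMinimumLimitedDominating k)
    minimumLimitedDominating k =
      descend ⊤ (⊤-isLimitedDominating k) (<-wellFounded ∣ ⊤ {order} ∣)
      where
      descend : ∀ D → IsLimitedDominating k D → Acc _<_ ∣ D ∣ →
                ∃ (IsMinimumLimitedDominating k)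
      descend D D-ld (acc smaller)
        with anySubset? (λ D′ → isLimitedDominating? k D′ ×-dec (∣ D′ ∣ <? ∣ D ∣))
      ... | yes (D′ , D′-ld , D′<D) = descend D′ D′-ld (smaller D′<D)
      ... | no none = D , D-ld , λ D′ D′-ld → ≮⇒≥ (λ D′<D → none (D′ , D′-ld , D′<D))

  γᴸ : ℕ → ℕ
  γᴸ k = ∣ proj₁ (minimumLimitedDominating k) ∣

DifferInExactlyOne : ∀ {d} → Rel (Vec Bool d) 0ℓ
DifferInExactlyOne x y = ∃! _≡_ (λ i → lookup x i ≢ lookup y i)

differInExactlyOne? : ∀ {d} → Decidable (DifferInExactlyOne {d})
differInExactlyOne? x y = any? λ i → differ? i ×-dec
  map′ (λ f {j} → f j) (λ f j → f {j}) (all? λ j → differ? j →-dec (i ≟ j))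
  where
  differ? : ∀ i → Dec (lookup x i ≢ lookup y i)
  differ? i = ¬? (lookup x i Bool.≟ lookup y i)

differInExactlyOne-sym : ∀ {d} → Symmetric (DifferInExactlyOne {d})
differInExactlyOne-sym (i , x≢y , unique) =
  i , x≢y ∘ sym , λ y≢x → unique (y≢x ∘ sym)

differInExactlyOne-irrefl : ∀ {d} → Irreflexive _≡_ (DifferInExactlyOne {d})
differInExactlyOne-irrefl refl (_ , x≢x , _) = x≢x refl

bitVectors : ∀ d → Fin (2 ^ d) ↔ Vec Bool d
bitVectors zero    = mk↔ₛ′ (λ _ → []) (λ _ → Fin.zero)
                           (λ { [] → refl }) (λ { Fin.zero → refl ; (Fin.suc ()) })
bitVectors (suc d) =
  cons ↔-∘ ((2↔Bool ×-↔ bitVectors d) ↔-∘ *↔× {2} {2 ^ d})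
  where
  cons : (Bool × Vec Bool d) ↔ Vec Bool (suc d)
  cons = mk↔ₛ′ (uncurry _∷_) uncons (λ { (b ∷ x) → refl }) (λ _ → refl)

Q : ℕ → Graph
Q d = record
  { Vertex      = Vec Bool d
  ; order       = 2 ^ d
  ; enumeration = bitVectors d
  ; Adj         = DifferInExactlyOne
  ; adj?        = differInExactlyOne?
  ; adj-sym     = λ {x} {y} → differInExactlyOne-sym {d} {x} {y}
  ; adj-irrefl  = differInExactlyOne-irrefl
  }

{-# OPTIONS --safe #-}
-- Every vertex of Q_d has d neighbours, so a (d-1)-limited dominating set is exactly a set D
-- in which every vertex of Q_d has a neighbour; call it totally dominating.
--
-- Upper bound: label the coordinates by words of length r over F_2 so that 2^r of them carry
-- each word exactly once, and let D be the set of x whose labels over the support sum to 0.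
-- Flipping a coordinate adds its label, so exactly one of the neighbours of a vertex in these
-- 2^r directions lies in D. Hence D is totally dominating and 2^r |D| = 2^d.
--
-- Lower bound: counting edges gives d |D| ≥ 2^d, which is enough for d = 2^r. For odd d let
-- the excess of y be one less than its number of neighbours in D. Two distinct vertices have
-- an even number of common neighbours, so the neighbours of a vertex outside D have odd, hence
-- positive, total excess. A vertex of excess e > 0 has d-1-e ≤ d-2 neighbours outside D, so
-- 2^d - |D| ≤ (d-2)(d |D| - 2^d), that is, (d-1) |D| ≥ 2^d.
module Submission where

open import Defs
open import Data.Bool using (Bool; true; false; not; _xor_)
import Data.Bool as Bool
open import Data.Bool.Properties
  using (not-involutive; not-¬; ¬-not; xor-assoc; xor-comm; xor-identityˡ; xor-same)
open import Data.Fin using (Fin; zero; suc)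
open import Data.Fin.Properties using (any?; _≟_)
import Data.Fin.Properties as Fin
open import Data.Fin.Subset using (Subset; ∣_∣; _─_)
import Data.Fin.Subset as Subset
open import Data.Fin.Subset.Properties
  using (_∈?_; p∩q≢∅⇒∣p─q∣<∣p∣; x∈p∧x∉q⇒x∈p─q; x∈p∩q⁺; p⊆q⇒∣p∣≤∣q∣)
open import Data.Nat
  using (ℕ; zero; suc; pred; _+_; _*_; _∸_; _^_; _≤_; _<_; z≤n; s≤s; NonZero; >-nonZero)
open import Data.Nat.Properties
  using ( +-suc; +-comm; +-identityʳ; +-mono-≤; +-monoˡ-≤; *-comm; *-identityʳ; *-zeroʳ
        ; *-monoˡ-≤; *-cancelˡ-≤; ^-distribˡ-+-*; m^n≢0; m^n>0; m+[n∸m]≡n; ∸-monoˡ-≤; ∸-monoʳ-<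
        ; m≤m+n; m≤n+m; ≤-trans; ≤-reflexive; ≤-antisym; <⇒≱; n≢0⇒n>0; suc-injective; suc-pred
        ; even≢odd; +-*-semiring; module ≤-Reasoning )
open import Data.Nat.Tactic.RingSolver using (solve-∀)
open import Data.Product using (_×_; _,_; proj₁; proj₂; ∃-syntax)
open import Data.Vec
  using (Vec; []; _∷_; lookup; tabulate; updateAt; zipWith; replicate)
open import Data.Vec.Properties
  using ( lookup∘tabulate; tabulate∘lookup; tabulate-cong; lookup∘updateAt; lookup∘updateAt′
        ; updateAt-updateAt; updateAt-id; updateAt-cong; updateAt-commutes
        ; []=⇒lookup; lookup⇒[]=; ≡-dec; zipWith-assoc; zipWith-comm; zipWith-identityˡ )
open import Function using (_∘_; id; _↔_; mk↔ₛ′; Inverse)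
open import Function.Construct.Composition using (_↔-∘_)
open import Function.Construct.Symmetry using (↔-sym)
open import Relation.Binary.PropositionalEquality
  using (_≡_; _≢_; _≗_; refl; sym; trans; cong; cong₂; subst; module ≡-Reasoning)
open import Relation.Nullary using (¬_; Dec; yes; no; does; contradiction)
open import Relation.Nullary.Decidable using (dec-true; dec-false)
open import Algebra.Properties.Semiring.Sum +-*-semiring
  using (sum; sum-syntax; sum-cong-≗; ∑-comm; ∑-distrib-+; ∑-permute; *-distribˡ-sum)

private variable
  d n r : ℕ

-- Finite sums and indicator counts.

χ : Bool → ℕ
χ true  = 1
χ false = 0

∑-const : ∀ n c → ∑[ i < n ] c ≡ n * c
∑-const zero    c = refl
∑-const (suc n) c = cong (c +_) (∑-const n c)

∑-mono-≤ : ∀ {n} {f g : Fin n → ℕ} → (∀ i → f i ≤ g i) → sum f ≤ sum g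
∑-mono-≤ {zero}  f≤g = z≤n
∑-mono-≤ {suc n} f≤g = +-mono-≤ (f≤g zero) (∑-mono-≤ (f≤g ∘ suc))

term≤∑ : ∀ {n} (f : Fin n → ℕ) i → f i ≤ sum f
term≤∑ f zero    = m≤m+n _ _
term≤∑ f (suc i) = ≤-trans (term≤∑ (f ∘ suc) i) (m≤n+m _ (f zero))

∑-none : ∀ {n} {P : Fin n → Set} (P? : ∀ i → Dec (P i)) → (∀ i → ¬ P i) →
         ∑[ i < n ] χ (does (P? i)) ≡ 0
∑-none {n} P? ¬P = begin
  ∑[ i < n ] χ (does (P? i))  ≡⟨ sum-cong-≗ (λ i → cong χ (dec-false (P? i) (¬P i))) ⟩
  ∑[ i < n ] 0                ≡⟨ ∑-const n 0 ⟩
  n * 0                       ≡⟨ *-zeroʳ n ⟩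
  0                           ∎
  where open ≡-Reasoning

∑-unique : ∀ {n} {P : Fin n → Set} (P? : ∀ i → Dec (P i)) k → P k → (∀ i → P i → k ≡ i) →
           ∑[ i < n ] χ (does (P? i)) ≡ 1
∑-unique P? zero p unique = cong₂ _+_
  (cong χ (dec-true (P? zero) p))
  (∑-none (P? ∘ suc) (λ i q → contradiction (unique (suc i) q) λ ()))
∑-unique P? (suc k) p unique = cong₂ _+_
  (cong χ (dec-false (P? zero) (λ q → contradiction (unique zero q) λ ())))
  (∑-unique (P? ∘ suc) k p (λ i q → Fin.suc-injective (unique (suc i) q)))

-- Off-diagonal entries pair up across the diagonal, so modulo 2 only the diagonal survives. This is
-- the parity tool for counting two-step walks; the induction peels off the first row and column.
∑∑-symmetric : ∀ {n} (a : Fin n → Fin n → ℕ) → (∀ i j → a i j ≡ a j i) →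
               ∃[ k ] ∑[ i < n ] ∑[ j < n ] a i j ≡ ∑[ i < n ] a i i + 2 * k
∑∑-symmetric {zero}  a a-sym = 0 , refl
∑∑-symmetric {suc n} a a-sym
  with k , eq ← ∑∑-symmetric (λ i j → a (suc i) (suc j)) (λ i j → a-sym (suc i) (suc j)) =
  row + k , (begin
  a zero zero + row + ∑[ i < n ] (a (suc i) zero + ∑[ j < n ] a (suc i) (suc j))
    ≡⟨ cong (a zero zero + row +_) (∑-distrib-+ (λ i → a (suc i) zero) _) ⟩
  a zero zero + row + (∑[ i < n ] a (suc i) zero + ∑[ i < n ] ∑[ j < n ] a (suc i) (suc j))
    ≡⟨ cong₂ (λ x y → a zero zero + row + (x + y)) (sum-cong-≗ (λ i → a-sym (suc i) zero)) eq ⟩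
  a zero zero + row + (row + (diagonal + 2 * k))
    ≡⟨ rearrange (a zero zero) row diagonal k ⟩
  a zero zero + diagonal + 2 * (row + k)
    ∎)
  where
  open ≡-Reasoning
  row      = ∑[ j < n ] a zero (suc j)
  diagonal = ∑[ i < n ] a (suc i) (suc i)
  rearrange : ∀ x s t k → x + s + (s + (t + 2 * k)) ≡ x + t + 2 * (s + k)
  rearrange = solve-∀

∣p∣≡∑ : (p : Subset n) → ∣ p ∣ ≡ ∑[ i < n ] χ (lookup p i)
∣p∣≡∑ []          = refl
∣p∣≡∑ (true  ∷ p) = cong suc (∣p∣≡∑ p)
∣p∣≡∑ (false ∷ p) = ∣p∣≡∑ p

-- Adjacency in the hypercube as flipping a coordinate.

flip : Fin d → Vec Bool d → Vec Bool d
flip i x = updateAt x i not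

flip-involutive : (i : Fin d) (x : Vec Bool d) → flip i (flip i x) ≡ x
flip-involutive i x = begin
  flip i (flip i x)           ≡⟨ updateAt-updateAt i x ⟩
  updateAt x i (not ∘ not)    ≡⟨ updateAt-cong i not-involutive x ⟩
  updateAt x i id             ≡⟨ updateAt-id i x ⟩
  x                           ∎
  where open ≡-Reasoning

flip-comm : (i j : Fin d) (x : Vec Bool d) → flip i (flip j x) ≡ flip j (flip i x)
flip-comm i j x with i ≟ j
... | yes refl = refl
... | no i≢j   = updateAt-commutes i j i≢j x

adj-flip : (i : Fin d) (x : Vec Bool d) → DifferInExactlyOne x (flip i x)
adj-flip i x = i , (λ eq → not-¬ refl (trans eq (lookup∘updateAt i x))) , λ {j} → unique j
  where
  unique : ∀ j → lookup x j ≢ lookup (flip i x) j → i ≡ j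
  unique j differ with i ≟ j
  ... | yes i≡j = i≡j
  ... | no i≢j  = contradiction (sym (lookup∘updateAt′ j i (i≢j ∘ sym) x)) differ

adj⇒flip : (x y : Vec Bool d) (a : DifferInExactlyOne x y) → y ≡ flip (proj₁ a) x
adj⇒flip x y (i , differ , unique) = begin
  y                             ≡⟨ tabulate∘lookup y ⟨
  tabulate (lookup y)           ≡⟨ tabulate-cong agree ⟩
  tabulate (lookup (flip i x))  ≡⟨ tabulate∘lookup (flip i x) ⟩
  flip i x                      ∎
  where
  open ≡-Reasoning
  agree : ∀ j → lookup y j ≡ lookup (flip i x) j
  agree j with i ≟ j
  ... | yes refl = trans (¬-not (differ ∘ sym)) (sym (lookup∘updateAt i x))
  ... | no i≢j with lookup x j Bool.≟ lookup y j
  ...   | yes same = trans (sym same) (sym (lookup∘updateAt′ j i (i≢j ∘ sym) x))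
  ...   | no diff  = contradiction (unique diff) i≢j

-- The coordinate in which `x` and `flip j x` differ is unique, and `eq` makes `i` such a
-- coordinate.
flip-injective : {x : Vec Bool d} (i j : Fin d) → flip i x ≡ flip j x → i ≡ j
flip-injective {x = x} i j eq =
  sym (proj₂ (proj₂ (adj-flip j x)) (subst (λ y → lookup x i ≢ lookup y i) eq
    (proj₁ (proj₂ (adj-flip i x)))))

-- Sums over the vertices of the hypercube.

vertex : Fin (2 ^ d) → Vec Bool d
vertex {d} = Graph.vertex (Q d)

index : Vec Bool d → Fin (2 ^ d)
index {d} = Graph.index (Q d)

vertex-index : (x : Vec Bool d) → vertex (index x) ≡ x
vertex-index = Inverse.strictlyInverseˡ (bitVectors _)

index-vertex : ∀ d (i : Fin (2 ^ d)) → index (vertex {d} i) ≡ i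
index-vertex d = Inverse.strictlyInverseʳ (bitVectors d)

infix 4 _≟ᵛ_
_≟ᵛ_ : (x y : Vec Bool d) → Dec (x ≡ y)
_≟ᵛ_ = ≡-dec Bool._≟_

∑-vertex : (x : Vec Bool d) → ∑[ i < 2 ^ d ] χ (does (vertex i ≟ᵛ x)) ≡ 1
∑-vertex {d} x = ∑-unique (λ i → vertex i ≟ᵛ x) (index x) (vertex-index x)
  (λ i eq → trans (cong index (sym eq)) (index-vertex d i))

∑ᵛ : (Vec Bool d → ℕ) → ℕ
∑ᵛ {d} f = ∑[ i < 2 ^ d ] f (vertex i)

∑ᵛ-cong : {f g : Vec Bool d → ℕ} → f ≗ g → ∑ᵛ f ≡ ∑ᵛ g
∑ᵛ-cong f≗g = sum-cong-≗ (f≗g ∘ vertex)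

∑ᵛ-const : ∀ d c → ∑ᵛ {d} (λ _ → c) ≡ 2 ^ d * c
∑ᵛ-const d = ∑-const (2 ^ d)

-- A flip is an involution, hence a permutation of the vertices; conjugating with the enumeration
-- gives the permutation of indices that reorders the sum.
∑ᵛ-flip : (i : Fin d) (f : Vec Bool d → ℕ) → ∑ᵛ (f ∘ flip i) ≡ ∑ᵛ f
∑ᵛ-flip {d} i f = sym (trans (∑-permute (f ∘ vertex) permutation)
  (sum-cong-≗ (λ j → cong f (vertex-index (flip i (vertex j))))))
  where
  permutation : Fin (2 ^ d) ↔ Fin (2 ^ d)
  permutation = ↔-sym (bitVectors d)
    ↔-∘ (mk↔ₛ′ (flip i) (flip i) (flip-involutive i) (flip-involutive i) ↔-∘ bitVectors d)

-- Exchanging the sums lets each direction be reindexed by its own flip. As `f` may depend on the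
-- direction, this moves weights on directed edges from one endpoint to the other.
∑ᵛ-∑-flip : (c : Fin n → Fin d) (f : Fin n → Vec Bool d → ℕ) →
            ∑ᵛ (λ x → ∑[ i < n ] f i (flip (c i) x)) ≡ ∑ᵛ (λ x → ∑[ i < n ] f i x)
∑ᵛ-∑-flip {n} {d} c f = begin
  ∑ᵛ (λ x → ∑[ i < n ] f i (flip (c i) x))  ≡⟨ ∑-comm {2 ^ d} {n} _ ⟩
  ∑[ i < n ] ∑ᵛ (f i ∘ flip (c i))          ≡⟨ sum-cong-≗ (λ i → ∑ᵛ-flip (c i) (f i)) ⟩
  ∑[ i < n ] ∑ᵛ (f i)                       ≡⟨ ∑-comm {n} {2 ^ d} _ ⟩
  ∑ᵛ (λ x → ∑[ i < n ] f i x)               ∎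
  where open ≡-Reasoning

-- Each vertex is reached once along each direction. The directions form a family `c`, since the
-- count for the code uses only `2 ^ r` of the coordinates.
∑ᵛ-neighbours : (c : Fin n → Fin d) (f : Vec Bool d → ℕ) →
                ∑ᵛ (λ x → ∑[ i < n ] f (flip (c i) x)) ≡ n * ∑ᵛ f
∑ᵛ-neighbours {n} {d} c f = begin
  ∑ᵛ (λ x → ∑[ i < n ] f (flip (c i) x))  ≡⟨ ∑-comm {2 ^ d} {n} _ ⟩
  ∑[ i < n ] ∑ᵛ (f ∘ flip (c i))          ≡⟨ sum-cong-≗ (λ i → ∑ᵛ-flip (c i) f) ⟩
  ∑[ i < n ] ∑ᵛ f                         ≡⟨ ∑-const n (∑ᵛ f) ⟩
  n * ∑ᵛ f                                ∎
  where open ≡-Reasoning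

-- Limited domination with bound d-1 as total domination.

TotallyDominating : (Vec Bool d → Bool) → Set
TotallyDominating m = ∀ x → ∃[ i ] m (flip i x) ≡ true

member : Subset (2 ^ d) → Vec Bool d → Bool
member D x = lookup D (index x)

∣D∣≡∑ᵛ : ∀ d (D : Subset (2 ^ d)) → ∣ D ∣ ≡ ∑ᵛ (χ ∘ member {d} D)
∣D∣≡∑ᵛ d D = trans (∣p∣≡∑ D) (sum-cong-≗ (λ i → cong (χ ∘ lookup D) (sym (index-vertex d i))))

-- Double count the pairs of a vertex and a direction leading to it from `x`: an adjacent vertex is
-- a flip in exactly one direction, and each flip is exactly one vertex.
∣N∣≡d : (x : Vec Bool d) → ∣ Graph.N (Q d) x ∣ ≡ d
∣N∣≡d {d} x = begin
  ∣ Graph.N (Q d) x ∣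
    ≡⟨ ∣p∣≡∑ (Graph.N (Q d) x) ⟩
  ∑[ j < 2 ^ d ] χ (lookup (Graph.N (Q d) x) j)
    ≡⟨ sum-cong-≗ (λ j → cong χ (lookup∘tabulate (λ j → does (differInExactlyOne? x (vertex j))) j)) ⟩
  ∑[ j < 2 ^ d ] χ (does (differInExactlyOne? x (vertex j)))
    ≡⟨ sum-cong-≗ (adj≡∑flip ∘ vertex) ⟩
  ∑[ j < 2 ^ d ] ∑[ i < d ] χ (does (vertex j ≟ᵛ flip i x))
    ≡⟨ ∑-comm {2 ^ d} {d} _ ⟩
  ∑[ i < d ] ∑[ j < 2 ^ d ] χ (does (vertex j ≟ᵛ flip i x))
    ≡⟨ sum-cong-≗ (λ i → ∑-vertex (flip i x)) ⟩
  ∑[ i < d ] 1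
    ≡⟨ trans (∑-const d 1) (*-identityʳ d) ⟩
  d ∎
  where
  open ≡-Reasoning
  adj≡∑flip : ∀ y → χ (does (differInExactlyOne? x y)) ≡ ∑[ i < d ] χ (does (y ≟ᵛ flip i x))
  adj≡∑flip y = by-cases (differInExactlyOne? x y)
    where
    by-cases : (a? : Dec (DifferInExactlyOne x y)) →
               χ (does a?) ≡ ∑[ i < d ] χ (does (y ≟ᵛ flip i x))
    by-cases (yes a) = sym (∑-unique (λ i → y ≟ᵛ flip i x) (proj₁ a) (adj⇒flip x y a)
      (λ i eq → flip-injective _ i (trans (sym (adj⇒flip x y a)) eq)))
    by-cases (no ¬a) = sym (∑-none (λ i → y ≟ᵛ flip i x)
      (λ { i refl → ¬a (adj-flip i x) }))

∈-N : (x y : Vec Bool d) → DifferInExactlyOne x y → index y Subset.∈ Graph.N (Q d) x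
∈-N {d} x y a = lookup⇒[]= (index y) _ (begin
  lookup (Graph.N (Q d) x) (index y)
    ≡⟨ lookup∘tabulate (λ j → does (differInExactlyOne? x (vertex j))) (index y) ⟩
  does (differInExactlyOne? x (vertex (index y)))
    ≡⟨ dec-true (differInExactlyOne? x (vertex (index y)))
         (subst (DifferInExactlyOne x) (sym (vertex-index y)) a) ⟩
  true ∎)
  where open ≡-Reasoning

N⇒adj : (x : Vec Bool d) (j : Fin (2 ^ d)) → j Subset.∈ Graph.N (Q d) x →
        DifferInExactlyOne x (vertex j)
N⇒adj x j j∈N with differInExactlyOne? x (vertex j)
  | trans (sym (lookup∘tabulate (λ j → does (differInExactlyOne? x (vertex j))) j)) ([]=⇒lookup j∈N)
... | yes a | _ = a
... | no _  | ()

totallyDominating⇒limitedDominating : (D : Subset (2 ^ d)) → TotallyDominating (member {d} D) →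
                                      Graph.IsLimitedDominating (Q d) (d ∸ 1) D
totallyDominating⇒limitedDominating {d} D total = dominating , limited
  where
  flip∈D : ∀ x → index (flip (proj₁ (total x)) x) Subset.∈ D
  flip∈D x = lookup⇒[]= _ D (proj₂ (total x))

  dominating : Graph.IsDominating (Q d) D
  dominating x _ = flip (proj₁ (total x)) x , flip∈D x , adj-flip (proj₁ (total x)) x

  limited : ∀ x → Graph._∈_ (Q d) x D → ∣ Graph.N (Q d) x ─ D ∣ ≤ d ∸ 1
  limited x _ = ∸-monoˡ-≤ 1 (subst (∣ Graph.N (Q d) x ─ D ∣ <_) (∣N∣≡d x)
    (p∩q≢∅⇒∣p─q∣<∣p∣ (Graph.N (Q d) x) D
      (_ , x∈p∩q⁺ (∈-N x _ (adj-flip (proj₁ (total x)) x) , flip∈D x))))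

-- Domination itself serves the vertices outside `D`. A vertex of `D` without a neighbour in `D`
-- would have all `d` neighbours outside, against the limit.
limitedDominating⇒totallyDominating : 1 ≤ d → (D : Subset (2 ^ d)) →
                                      Graph.IsLimitedDominating (Q d) (d ∸ 1) D →
                                      TotallyDominating (member {d} D)
limitedDominating⇒totallyDominating {d} 1≤d D (dominating , limited) x
  with any? (λ i → member D (flip i x) Bool.≟ true)
... | yes found = found
... | no none with index x ∈? D
...   | no x∉D with y , y∈D , a ← dominating x x∉D =
  contradiction
    (proj₁ a , subst (λ z → member D z ≡ true) (adj⇒flip x y a) ([]=⇒lookup y∈D)) none
-- Here `1 ≤ d` guarantees that the truncated `d ∸ 1` is smaller than `d`.
...   | yes x∈D = contradiction d≤d∸1 (<⇒≱ (∸-monoʳ-< (s≤s z≤n) 1≤d))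
  where
  N⊆N─D : Graph.N (Q d) x Subset.⊆ Graph.N (Q d) x ─ D
  N⊆N─D {j} j∈N = x∈p∧x∉q⇒x∈p─q j∈N λ j∈D → none (proj₁ (N⇒adj x j j∈N) , (begin
    member D (flip (proj₁ (N⇒adj x j j∈N)) x)  ≡⟨ cong (member D) (adj⇒flip x (vertex j) (N⇒adj x j j∈N)) ⟨
    member {d} D (vertex j)                  ≡⟨ cong (lookup D) (index-vertex d j) ⟩
    lookup D j                               ≡⟨ []=⇒lookup j∈D ⟩
    true                                     ∎))
    where open ≡-Reasoning

  d≤d∸1 : d ≤ d ∸ 1
  d≤d∸1 = begin
    d                          ≡⟨ ∣N∣≡d x ⟨
    ∣ Graph.N (Q d) x ∣        ≤⟨ p⊆q⇒∣p∣≤∣q∣ N⊆N─D ⟩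
    ∣ Graph.N (Q d) x ─ D ∣    ≤⟨ limited x x∈D ⟩
    d ∸ 1                      ∎
    where open ≤-Reasoning

-- Lower bounds by double counting.

coverage : (Vec Bool d → Bool) → Vec Bool d → ℕ
coverage {d} m x = ∑[ i < d ] χ (m (flip i x))

coverage-positive : (m : Vec Bool d → Bool) → TotallyDominating m → ∀ x → 1 ≤ coverage m x
coverage-positive m total x with i , eq ← total x =
  subst (λ b → χ b ≤ coverage m x) eq (term≤∑ (λ i → χ (m (flip i x))) i)

volume-bound : (m : Vec Bool d → Bool) → TotallyDominating m → 2 ^ d ≤ d * ∑ᵛ (χ ∘ m)
volume-bound {d} m total = begin
  2 ^ d              ≡⟨ *-identityʳ (2 ^ d) ⟨
  2 ^ d * 1          ≡⟨ ∑ᵛ-const d 1 ⟨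
  ∑ᵛ {d} (λ _ → 1)   ≤⟨ ∑-mono-≤ (coverage-positive m total ∘ vertex) ⟩
  ∑ᵛ (coverage m)    ≡⟨ ∑ᵛ-neighbours id (χ ∘ m) ⟩
  d * ∑ᵛ (χ ∘ m)     ∎
  where open ≤-Reasoning

χ-not : ∀ b → χ (not b) + χ b ≡ 1
χ-not true  = refl
χ-not false = refl

-- The equations W + C = V and V + E = (p+2)C together with W ≤ pE eliminate W and E. The identity
-- p(p+2) + 1 = (p+1)² then leaves a common factor p+1 to cancel.
excess-bound : ∀ q (m : Vec Bool (suc (2 * suc q)) → Bool) → TotallyDominating m →
               2 ^ suc (2 * suc q) ≤ (2 * suc q) * ∑ᵛ (χ ∘ m)
excess-bound q m total = *-cancelˡ-≤ (suc p) (begin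
  suc p * V                                 ≡⟨⟩
  V + p * V                                 ≡⟨ cong (_+ p * V) W+C≡V ⟨
  W + C + p * V                             ≤⟨ +-monoˡ-≤ (p * V) (+-monoˡ-≤ C W≤pE) ⟩
  p * E + C + p * V                         ≡⟨ rearrange p E C V ⟩
  p * (V + E) + C                           ≡⟨ cong (λ t → p * t + C) V+E≡dC ⟩
  p * (suc (suc p) * C) + C                 ≡⟨ square p C ⟩
  suc p * (2 * suc q * C)                   ∎)
  where
  open ≤-Reasoning
  d′ = suc (2 * suc q)
  -- This is the dimension minus 2; `suc p` reduces to `2 * suc q` and `suc (suc p)` to `d′`.
  p = pred (2 * suc q)
  e : Vec Bool d′ → ℕ
  -- Total domination makes the coverage positive, so `pred` is an exact subtraction.
  e x = pred (coverage m x)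
  coverage≡1+e : ∀ x → coverage m x ≡ 1 + e x
  coverage≡1+e x = sym (suc-pred (coverage m x) {{>-nonZero (coverage-positive m total x)}})
  V = 2 ^ d′
  C = ∑ᵛ (χ ∘ m)
  W = ∑ᵛ (χ ∘ not ∘ m)
  E = ∑ᵛ e

  rearrange : ∀ p E C V → p * E + C + p * V ≡ p * (V + E) + C
  rearrange = solve-∀
  square : ∀ p C → p * (suc (suc p) * C) + C ≡ suc p * (suc p * C)
  square = solve-∀

  W+C≡V : W + C ≡ V
  W+C≡V = begin-equality
    W + C                                  ≡⟨ ∑-distrib-+ (χ ∘ not ∘ m ∘ vertex) _ ⟨
    ∑ᵛ (λ x → χ (not (m x)) + χ (m x))     ≡⟨ ∑ᵛ-cong (χ-not ∘ m) ⟩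
    ∑ᵛ {d′} (λ _ → 1)                      ≡⟨ ∑ᵛ-const d′ 1 ⟩
    V * 1                                  ≡⟨ *-identityʳ V ⟩
    V                                      ∎

  V+E≡dC : V + E ≡ suc (suc p) * C
  V+E≡dC = begin-equality
    V + E                        ≡⟨ cong (_+ E) (trans (sym (*-identityʳ V)) (sym (∑ᵛ-const d′ 1))) ⟩
    ∑ᵛ {d′} (λ _ → 1) + E        ≡⟨ ∑-distrib-+ {2 ^ d′} (λ _ → 1) (e ∘ vertex) ⟨
    ∑ᵛ (λ x → 1 + e x)           ≡⟨ ∑ᵛ-cong coverage≡1+e ⟨
    ∑ᵛ (coverage m)              ≡⟨ ∑ᵛ-neighbours id (χ ∘ m) ⟩
    d′ * C                       ∎

  -- The coverages of the neighbours of `x` add up to the number of two-step walks from `x` into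
  -- `m`. Walks returning to `x` do not end in `m`, and the others pair up by exchanging their
  -- directions, so the number is even. Without excess it would be the odd `d′`.
  excess-near : ∀ x → m x ≡ false → 0 < ∑[ i < d′ ] e (flip i x)
  excess-near x x∉m = n≢0⇒n>0 λ none →
    even≢odd (proj₁ twice) (suc q) (sym (begin-equality
    d′                                                  ≡⟨ +-identityʳ d′ ⟨
    d′ + 0                                              ≡⟨ cong₂ _+_ (trans (∑-const d′ 1) (*-identityʳ d′)) none ⟨
    ∑[ i < d′ ] 1 + ∑[ i < d′ ] e (flip i x)            ≡⟨ ∑-distrib-+ {d′} (λ _ → 1) (λ i → e (flip i x)) ⟨
    ∑[ i < d′ ] (1 + e (flip i x))                      ≡⟨ sum-cong-≗ {d′} (λ i → coverage≡1+e (flip i x)) ⟨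
    ∑[ i < d′ ] ∑[ j < d′ ] a i j                       ≡⟨ proj₂ twice ⟩
    ∑[ i < d′ ] a i i + 2 * proj₁ twice                 ≡⟨ cong (_+ 2 * proj₁ twice) diagonal≡0 ⟩
    2 * proj₁ twice                                     ∎))
    where
    a : Fin d′ → Fin d′ → ℕ
    a i j = χ (m (flip j (flip i x)))
    twice = ∑∑-symmetric a (λ i j → cong (χ ∘ m) (flip-comm j i x))
    diagonal≡0 : ∑[ i < d′ ] a i i ≡ 0
    diagonal≡0 = begin-equality
      ∑[ i < d′ ] a i i  ≡⟨ sum-cong-≗ {d′} (λ i → cong χ (trans (cong m (flip-involutive i x)) x∉m)) ⟩
      ∑[ i < d′ ] 0      ≡⟨ ∑-const d′ 0 ⟩
      d′ * 0             ≡⟨ *-zeroʳ d′ ⟩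
      0                  ∎

  outside≤excess : ∀ x → χ (not (m x)) ≤ ∑[ i < d′ ] (χ (not (m x)) * e (flip i x))
  outside≤excess x with m x in eq
  ... | true  = z≤n
  ... | false = subst (1 ≤_) (sum-cong-≗ {d′} (λ i → sym (+-identityʳ (e (flip i x))))) (excess-near x eq)

  neighbours-outside : ∀ x → coverage (not ∘ m) x + e x ≡ suc p
  neighbours-outside x = suc-injective (begin-equality
    suc (coverage (not ∘ m) x + e x)                             ≡⟨ +-suc _ (e x) ⟨
    coverage (not ∘ m) x + (1 + e x)                             ≡⟨ cong (coverage (not ∘ m) x +_) (coverage≡1+e x) ⟨
    coverage (not ∘ m) x + coverage m x
      ≡⟨ ∑-distrib-+ {d′} (λ i → χ (not (m (flip i x)))) (λ i → χ (m (flip i x))) ⟨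
    ∑[ i < d′ ] (χ (not (m (flip i x))) + χ (m (flip i x)))      ≡⟨ sum-cong-≗ {d′} (λ i → χ-not (m (flip i x))) ⟩
    ∑[ i < d′ ] 1                                                ≡⟨ trans (∑-const d′ 1) (*-identityʳ d′) ⟩
    suc (suc p)                                                  ∎)

  -- Positive excess means at least two neighbours in `m`, hence at most `p` outside. At zero excess
  -- there are `p + 1` outside, but the factor `e x` vanishes.
  excess-outside : ∀ x → e x * coverage (not ∘ m) x ≤ p * e x
  excess-outside x = by-cases (e x) (neighbours-outside x)
    where
    by-cases : ∀ k {l} → l + k ≡ suc p → k * l ≤ p * k
    by-cases zero    _          = z≤n
    by-cases (suc k) {l} l+k≡ = begin
      suc k * l  ≡⟨ *-comm (suc k) l ⟩
      l * suc k  ≤⟨ *-monoˡ-≤ (suc k) (≤-trans (m≤m+n l k)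
                      (≤-reflexive (suc-injective (trans (sym (+-suc l k)) l+k≡)))) ⟩
      p * suc k  ∎

  W≤pE : W ≤ p * E
  W≤pE = begin
    ∑ᵛ (χ ∘ not ∘ m)
      ≤⟨ ∑-mono-≤ (outside≤excess ∘ vertex) ⟩
    ∑ᵛ (λ x → ∑[ i < d′ ] (χ (not (m x)) * e (flip i x)))
      -- Each edge weight moves to its other endpoint, so that the outer sum runs over the vertex
      -- carrying the excess.
      ≡⟨ ∑ᵛ-∑-flip id (λ i x → χ (not (m x)) * e (flip i x)) ⟨
    ∑ᵛ (λ x → ∑[ i < d′ ] (χ (not (m (flip i x))) * e (flip i (flip i x))))
      ≡⟨ ∑ᵛ-cong (λ x → sum-cong-≗ {d′} (λ i → trans
           (cong (λ y → χ (not (m (flip i x))) * e y) (flip-involutive i x))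
           (*-comm (χ (not (m (flip i x)))) (e x)))) ⟩
    ∑ᵛ (λ x → ∑[ i < d′ ] (e x * χ (not (m (flip i x)))))
      ≡⟨ ∑ᵛ-cong (λ x → *-distribˡ-sum {d′} (e x) (λ i → χ (not (m (flip i x))))) ⟨
    ∑ᵛ (λ x → e x * coverage (not ∘ m) x)
      ≤⟨ ∑-mono-≤ (excess-outside ∘ vertex) ⟩
    ∑ᵛ (λ x → p * e x)
      ≡⟨ *-distribˡ-sum p (e ∘ vertex) ⟨
    p * E ∎

-- Linear codes over F_2.

infixl 6 _⊕_
_⊕_ : Vec Bool r → Vec Bool r → Vec Bool r
_⊕_ = zipWith _xor_

𝟎 : Vec Bool r
𝟎 = replicate _ false

⊕-assoc : (x y z : Vec Bool r) → (x ⊕ y) ⊕ z ≡ x ⊕ (y ⊕ z)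
⊕-assoc = zipWith-assoc xor-assoc

⊕-comm : (x y : Vec Bool r) → x ⊕ y ≡ y ⊕ x
⊕-comm = zipWith-comm xor-comm

⊕-identityˡ : (x : Vec Bool r) → 𝟎 ⊕ x ≡ x
⊕-identityˡ = zipWith-identityˡ xor-identityˡ

⊕-self : (x : Vec Bool r) → x ⊕ x ≡ 𝟎
⊕-self []      = refl
⊕-self (b ∷ x) = cong₂ _∷_ (xor-same b) (⊕-self x)

⊕-cancel : (x y : Vec Bool r) → x ⊕ (x ⊕ y) ≡ y
⊕-cancel x y = begin
  x ⊕ (x ⊕ y)  ≡⟨ ⊕-assoc x x y ⟨
  (x ⊕ x) ⊕ y  ≡⟨ cong (_⊕ y) (⊕-self x) ⟩
  𝟎 ⊕ y        ≡⟨ ⊕-identityˡ y ⟩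
  y            ∎
  where open ≡-Reasoning

⊕≡𝟎⇒≡ : {x y : Vec Bool r} → x ⊕ y ≡ 𝟎 → x ≡ y
⊕≡𝟎⇒≡ {x = x} {y} eq = begin
  x            ≡⟨ ⊕-identityˡ x ⟨
  𝟎 ⊕ x        ≡⟨ ⊕-comm 𝟎 x ⟩
  x ⊕ 𝟎        ≡⟨ cong (x ⊕_) eq ⟨
  x ⊕ (x ⊕ y)  ≡⟨ ⊕-cancel x y ⟩
  y            ∎
  where open ≡-Reasoning

-- The product of the parity-check matrix with columns `c` and the vector `x`.
syndrome : (Fin d → Vec Bool r) → Vec Bool d → Vec Bool r
syndrome c []          = 𝟎
syndrome c (true  ∷ x) = c zero ⊕ syndrome (c ∘ suc) x
syndrome c (false ∷ x) = syndrome (c ∘ suc) x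

syndrome-flip : (c : Fin d → Vec Bool r) (i : Fin d) (x : Vec Bool d) →
                syndrome c (flip i x) ≡ c i ⊕ syndrome c x
-- Switching a coordinate off removes its label, which over F_2 is the same as adding it.
syndrome-flip c zero    (true  ∷ x) = sym (⊕-cancel (c zero) _)
syndrome-flip c zero    (false ∷ x) = refl
syndrome-flip c (suc i) (false ∷ x) = syndrome-flip (c ∘ suc) i x
syndrome-flip c (suc i) (true  ∷ x) = begin
  c zero ⊕ s (flip i x)       ≡⟨ cong (c zero ⊕_) (syndrome-flip (c ∘ suc) i x) ⟩
  c zero ⊕ (c (suc i) ⊕ s x)  ≡⟨ ⊕-assoc (c zero) _ _ ⟨
  (c zero ⊕ c (suc i)) ⊕ s x  ≡⟨ cong (_⊕ s x) (⊕-comm (c zero) _) ⟩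
  (c (suc i) ⊕ c zero) ⊕ s x  ≡⟨ ⊕-assoc (c (suc i)) _ _ ⟩
  c (suc i) ⊕ (c zero ⊕ s x)  ∎
  where
  open ≡-Reasoning
  s = syndrome (c ∘ suc)

code : (Fin d → Vec Bool r) → Subset (2 ^ d)
code c = tabulate (λ i → does (syndrome c (vertex i) ≟ᵛ 𝟎))

member-code : (c : Fin d → Vec Bool r) (x : Vec Bool d) →
              member (code c) x ≡ does (syndrome c x ≟ᵛ 𝟎)
member-code c x = trans
  (lookup∘tabulate (λ i → does (syndrome c (vertex i) ≟ᵛ 𝟎)) (index x))
  (cong (λ y → does (syndrome c y ≟ᵛ 𝟎)) (vertex-index x))

-- The flip adds `c i` to the syndrome, and over F_2 a sum of two words vanishes exactly when they
-- are equal.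
member-code-flip : (c : Fin d → Vec Bool r) (i : Fin d) (x : Vec Bool d) →
                   member (code c) (flip i x) ≡ does (c i ≟ᵛ syndrome c x)
member-code-flip c i x = begin
  member (code c) (flip i x)             ≡⟨ member-code c (flip i x) ⟩
  does (syndrome c (flip i x) ≟ᵛ 𝟎)      ≡⟨ cong (λ s → does (s ≟ᵛ 𝟎)) (syndrome-flip c i x) ⟩
  does (c i ⊕ syndrome c x ≟ᵛ 𝟎)         ≡⟨ by-cases (c i ≟ᵛ syndrome c x) ⟩
  does (c i ≟ᵛ syndrome c x)             ∎
  where
  open ≡-Reasoning
  by-cases : ∀ {y z : Vec Bool _} (y≟z : Dec (y ≡ z)) → does (y ⊕ z ≟ᵛ 𝟎) ≡ does y≟z
  by-cases {y} (yes refl) = dec-true (y ⊕ y ≟ᵛ 𝟎) (⊕-self y)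
  by-cases {y} {z} (no y≢z) = dec-false (y ⊕ z ≟ᵛ 𝟎) (y≢z ∘ ⊕≡𝟎⇒≡)

-- Flip the coordinate whose label is the syndrome of `x`; `g` finds it. The zero word is among the
-- labels, so codewords have a neighbour in the code too.
code-totallyDominating : (c : Fin d → Vec Bool r) (g : Fin (2 ^ r) → Fin d) → c ∘ g ≗ vertex →
                         TotallyDominating (member (code c))
code-totallyDominating c g c∘g x = i , (begin
  member (code c) (flip i x)  ≡⟨ member-code-flip c i x ⟩
  does (c i ≟ᵛ s)             ≡⟨ dec-true (c i ≟ᵛ s) (trans (c∘g (index s)) (vertex-index s)) ⟩
  true                        ∎)
  where
  open ≡-Reasoning
  s = syndrome c x
  i = g (index s)

-- Along the directions chosen by `g`, every codeword is reached from `2 ^ r` vertices, while every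
-- vertex reaches the code in exactly one of them.
2^r*∣code∣≡2^d : (c : Fin d → Vec Bool r) (g : Fin (2 ^ r) → Fin d) → c ∘ g ≗ vertex →
            2 ^ r * ∣ code c ∣ ≡ 2 ^ d
2^r*∣code∣≡2^d {d} {r} c g c∘g = begin
  2 ^ r * ∣ code c ∣
    ≡⟨ cong (2 ^ r *_) (∣D∣≡∑ᵛ d (code c)) ⟩
  2 ^ r * ∑ᵛ {d} (χ ∘ member (code c))
    ≡⟨ ∑ᵛ-neighbours g (χ ∘ member (code c)) ⟨
  ∑ᵛ (λ x → ∑[ i < 2 ^ r ] χ (member (code c) (flip (g i) x)))
    ≡⟨ ∑ᵛ-cong (λ x → sum-cong-≗ (λ i → cong χ (trans (member-code-flip c (g i) x)
         (cong (λ y → does (y ≟ᵛ syndrome c x)) (c∘g i))))) ⟩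
  ∑ᵛ (λ x → ∑[ i < 2 ^ r ] χ (does (vertex i ≟ᵛ syndrome c x)))
    ≡⟨ ∑ᵛ-cong (∑-vertex ∘ syndrome c) ⟩
  ∑ᵛ {d} (λ _ → 1)
    ≡⟨ trans (∑ᵛ-const d 1) (*-identityʳ (2 ^ d)) ⟩
  2 ^ d ∎
  where open ≡-Reasoning

-- Matching the upper and lower bounds.

-- After multiplication by `2 ^ r`, both the code and a minimum set are compared with `2 ^ d`. The
-- factor in the lower bound is d in the first case of the theorem and d-1 in the second; both equal
-- `2 ^ r`.
γᴸ-from-bounds : ∀ r {d k} → 1 ≤ d → r + k ≡ d →
  (∀ (m : Vec Bool d → Bool) → TotallyDominating m → 2 ^ d ≤ 2 ^ r * ∑ᵛ (χ ∘ m)) →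
  (c : Fin d → Vec Bool r) (g : Fin (2 ^ r) → Fin d) → c ∘ g ≗ vertex →
  Graph.γᴸ (Q d) (d ∸ 1) ≡ 2 ^ k
γᴸ-from-bounds r {d} {k} 1≤d r+k≡d lower c g c∘g
  with D , D-ld , minimal ← Graph.minimumLimitedDominating (Q d) (d ∸ 1) =
  ≤-antisym
    (≤-trans (minimal (code c) (totallyDominating⇒limitedDominating (code c)
                                 (code-totallyDominating c g c∘g)))
             (*-cancelˡ-≤ (2 ^ r) (≤-reflexive (trans (2^r*∣code∣≡2^d c g c∘g) 2^d≡))))
    (*-cancelˡ-≤ (2 ^ r) (begin
      2 ^ r * 2 ^ k                 ≡⟨ 2^d≡ ⟨
      2 ^ d                         ≤⟨ lower (member D) (limitedDominating⇒totallyDominating 1≤d D D-ld) ⟩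
      2 ^ r * ∑ᵛ {d} (χ ∘ member D)     ≡⟨ cong (2 ^ r *_) (∣D∣≡∑ᵛ d D) ⟨
      2 ^ r * ∣ D ∣                 ∎))
  where
  open ≤-Reasoning
  instance
    2^r≢0 : NonZero (2 ^ r)
    2^r≢0 = m^n≢0 2 r
  2^d≡ : 2 ^ d ≡ 2 ^ r * 2 ^ k
  2^d≡ = trans (cong (2 ^_) (sym r+k≡d)) (^-distribˡ-+-* 2 r k)

-- Makes the truncated `2 ^ r ∸ r` a true difference.
r≤2^r : ∀ r → r ≤ 2 ^ r
r≤2^r zero    = z≤n
r≤2^r (suc r) = +-mono-≤ (m^n>0 2 r) (≤-trans (r≤2^r r) (m≤m+n _ 0))

corollary20 : (r : ℕ) → 1 ≤ r →
    ((d : ℕ) → d ≡ 2 ^ r → Graph.γᴸ (Q d) (d ∸ 1) ≡ 2 ^ (2 ^ r ∸ r)) ×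
    ((d : ℕ) → d ≡ 2 ^ r + 1 → Graph.γᴸ (Q d) (d ∸ 1) ≡ 2 ^ ((2 ^ r ∸ r) + 1))
corollary20 r@(suc s) _ =
  -- For d = `2 ^ r` the enumeration `vertex` itself labels the coordinates, each word occurring
  -- once.
  (λ { _ refl → γᴸ-from-bounds r (m^n>0 2 r) r+[2^r∸r] volume-bound vertex id (λ _ → refl) }) ,
  (λ { _ refl → subst (λ d → Graph.γᴸ (Q d) (d ∸ 1) ≡ 2 ^ ((2 ^ r ∸ r) + 1))
                      (sym (+-comm (2 ^ r) 1)) odd })
  where
  r+[2^r∸r] : r + (2 ^ r ∸ r) ≡ 2 ^ r
  r+[2^r∸r] = m+[n∸m]≡n (r≤2^r r)

  odd-lower : ∀ h → 1 ≤ h → (m : Vec Bool (suc (2 * h)) → Bool) → TotallyDominating m →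
              2 ^ suc (2 * h) ≤ 2 * h * ∑ᵛ (χ ∘ m)
  odd-lower (suc q) _ = excess-bound q

  odd : Graph.γᴸ (Q (suc (2 ^ r))) (2 ^ r) ≡ 2 ^ ((2 ^ r ∸ r) + 1)
  odd = γᴸ-from-bounds r {suc (2 ^ r)} (s≤s z≤n)
    (trans (cong (r +_) (+-comm _ 1)) (trans (+-suc r _) (cong suc r+[2^r∸r])))
    -- With r = `suc s`, `2 ^ r` unfolds to `2 * 2 ^ s`, which displays the dimension as odd.
    (odd-lower (2 ^ s) (m^n>0 2 s))
    -- The extra coordinate `zero` gets the label `𝟎`; the others carry each word once, and `suc`
    -- selects them.
    (λ { zero → 𝟎 ; (suc i) → vertex i }) suc (λ _ → refl)
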